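{- Let $k\ne h$ be positive integers and let $n$ be a positive integer such that $n>1$ or $k+h$ is odd (or both). Then $$\zeta(n,k,h)=\mathcal{Z}(2n,k,h).$$
   Context: A primitive prime divisor of the $n$-th term of a sequence (indexed by positive integers) is a prime dividing the $n$-th term and no earlier term. $\mathcal{Z}(n,k,h)$ is the product of the primitive prime divisors of the term $k^n-h^n$ of the sequence $(k^u-h^u)_{u\ge1}$, and $\zeta(n,k,h)$ is the product of the primitive prime divisors of the term $k^n+h^n$ of the sequence $(k^u+h^u)_{u\ge1}$; in both cases each prime is counted with the multiplicity with which it divides the term (empty product $=1$).
   Formalization: For n = 1 it is additionally assumed that k and h are coprime; without this the claim is false, e.g. n = 1, k = 3, h = 6 gives ζ(1,3,6) = 9 but Z(2,3,6) = 1, and it fails whenever n = 1 and gcd(k,h) > 1. -}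

module Defs where

open import Data.Nat.Base using (ℕ; zero; suc; _≤_; _<_; _^_)
open import Data.Nat.Properties using (_≤?_; allUpTo?)
open import Data.Nat.ListAction using (product)
open import Data.Nat.Primality using (Prime; prime?)
open import Data.Nat.Primality.Factorisation using (factors; factorise)
import Data.Nat.Divisibility as ℕ
open import Data.Integer.Base using (ℤ; +_; _+_; _-_; ∣_∣)
open import Data.Integer.Divisibility using (_∣_)
open import Data.List.Base using (List; []; filter)
open import Data.Product.Base using (_×_)
open import Relation.Binary.PropositionalEquality.Core using (_≡_)
open import Relation.Nullary using (¬_; Dec; ¬?; _×-dec_; _→-dec_)

-- Sequences are indexed by the positive integers; the value at 0 is never used.
PrimitivePrimeDivisor : (ℕ → ℤ) → ℕ → ℕ → Set
PrimitivePrimeDivisor a n p =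
  Prime p × (+ p ∣ a n) × (∀ {u} → u < n → 1 ≤ u → ¬ (+ p ∣ a u))

primitivePrimeDivisor? : ∀ a n p → Dec (PrimitivePrimeDivisor a n p)
primitivePrimeDivisor? a n p =
  prime? p ×-dec (p ℕ.∣? ∣ a n ∣) ×-dec
  allUpTo? (λ u → (1 ≤? u) →-dec ¬? (p ℕ.∣? ∣ a u ∣)) n

-- Each prime occurs as often as its multiplicity in m.  The value at 0 is
-- arbitrary: k ^ n - h ^ n and k ^ n + h ^ n are nonzero for distinct positive
-- k, h and n ≥ 1.
primeFactors : ℕ → List ℕ
primeFactors zero      = []
primeFactors m@(suc _) = factors (factorise m)

primitivePart : (ℕ → ℤ) → ℕ → ℕ
primitivePart a n =
  product (filter (primitivePrimeDivisor? a n) (primeFactors ∣ a n ∣))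

𝒵 : ℕ → ℕ → ℕ → ℕ
𝒵 n k h = primitivePart (λ u → + (k ^ u) - + (h ^ u)) n

ζ : ℕ → ℕ → ℕ → ℕ
ζ n k h = primitivePart (λ u → + (k ^ u) + + (h ^ u)) n

-- For n = 1 a common prime factor of k and h is primitive in k + h but not in
-- k ^ 2 - h ^ 2, since it already divides k - h.  So ζ 1 k h ≡ 𝒵 2 k h needs
-- k and h coprime, even when k + h is odd.
ζ[1,3,6]≢𝒵[2,3,6] : ¬ (ζ 1 3 6 ≡ 𝒵 2 3 6)
ζ[1,3,6]≢𝒵[2,3,6] ()

{-# OPTIONS --safe #-}
-- Write K u = k ^ u and H u = h ^ u.  Two identities,
--   K (u + v) + H (u + v) = K u (K v + H v) - H v (K u - H u),
--   K (n + v) - H (n + v) = K v (K n + H n) - H n (K v + H v),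
-- show that an odd prime p coprime to k and h which is primitive in K n + H n
-- divides no K u - H u with 1 ≤ u < 2 n.  Conversely a prime that is primitive
-- in K (2 n) - H (2 n) = (K n - H n) (K n + H n) divides only the second
-- factor, which gives primitivity there and also the equality of multiplicities.
module Submission where

open import Defs
open import Data.Nat.Base using (ℕ; _+_; _*_; _<_; _≤_)
open import Data.Nat.Divisibility using (_∤_)
open import Data.Nat.Coprimality using (Coprime)
open import Data.Sum.Base using (_⊎_)
open import Relation.Binary.PropositionalEquality.Core using (_≡_; _≢_)

open import Data.Nat.Base using (zero; suc; _^_; NonZero; ≢-nonZero; >-nonZero)
import Data.Nat.Properties as ℕ
import Data.Nat.Divisibility as ℕ∣
open import Data.Nat.ListAction using (product)
open import Data.Nat.ListAction.Properties using (product-++; product-↭; ∈⇒∣product)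
open import Data.Nat.Primality using (Prime; prime[2]; ¬prime[1]; euclidsLemma; prime⇒irreducible)
open import Data.Nat.Primality.Factorisation
open import Data.Integer.Base as ℤ using (ℤ; +_; ∣_∣)
import Data.Integer.Properties as ℤ
open import Data.Integer.Divisibility using (_∣_)
import Data.Integer.Divisibility.Signed as Signed
open import Data.Integer.Tactic.RingSolver using (solve-∀)
open import Data.List.Base using ([]; _++_; filter)
open import Data.List.Properties using (filter-++; filter-none; filter-≐)
open import Data.List.Relation.Binary.Permutation.Propositional using (_↭_)
open import Data.List.Relation.Binary.Permutation.Propositional.Properties using (filter-↭)
open import Data.List.Relation.Unary.All as All using (All)
import Data.List.Relation.Unary.All.Properties as All
open import Data.Product.Base using (_,_)
open import Data.Sum.Base using (inj₁; inj₂; [_,_]′)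
open import Function.Base using (_∘_; id)
open import Relation.Binary.Definitions using (tri<; tri≈; tri>)
open import Relation.Binary.PropositionalEquality using (refl; sym; trans; cong; cong₂; subst; module ≡-Reasoning)
open import Relation.Nullary using (¬_; contradiction)
open import Relation.Unary using (Pred; Decidable)

open PrimeFactorisation using (isFactorisation; factorsPrime)

-- Prime factors of a product, with multiplicity.

primeFactors-↭ : ∀ {m} .{{_ : NonZero m}} (f : PrimeFactorisation m) →
                 primeFactors m ↭ factors f
primeFactors-↭ {suc m} f = factorisationUnique (factorise (suc m)) f

*-primeFactorisation : ∀ {m n} → PrimeFactorisation m → PrimeFactorisation n →
                       PrimeFactorisation (m * n)
*-primeFactorisation f g = record
  { factors         = factors f ++ factors g
  ; isFactorisation = trans (cong₂ _*_ (isFactorisation f) (isFactorisation g))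
                            (sym (product-++ (factors f) (factors g)))
  ; factorsPrime    = All.++⁺ (factorsPrime f) (factorsPrime g)
  }

primeFactors-* : ∀ m n .{{_ : NonZero m}} .{{_ : NonZero n}} →
                 primeFactors (m * n) ↭ primeFactors m ++ primeFactors n
primeFactors-* m@(suc _) n@(suc _) =
  primeFactors-↭ (*-primeFactorisation (factorise m) (factorise n))

primeFactors-∣ : ∀ m → All (ℕ∣._∣ m) (primeFactors m)
primeFactors-∣ zero      = All.[]
primeFactors-∣ m@(suc _) = All.tabulate λ {p} p∈ →
  subst (p ℕ∣.∣_) (sym (isFactorisation (factorise m))) (∈⇒∣product p∈)

module _ {ℓ} {P : Pred ℕ ℓ} (P? : Decidable P) where

  -- Every prime in the list of `m` divides `m`, so `P?` rejects it, and the surviving primes keep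
  -- exactly their multiplicity in `n`. This upgrades an equality of sets of primes to an equality
  -- of products with multiplicity.
  product-filter-primeFactors-* :
    ∀ m n .{{_ : NonZero m}} .{{_ : NonZero n}} → (∀ {p} → P p → p ∤ m) →
    product (filter P? (primeFactors (m * n))) ≡ product (filter P? (primeFactors n))
  product-filter-primeFactors-* m n P⇒∤m = begin
    product (filter P? (primeFactors (m * n)))
      ≡⟨ product-↭ (filter-↭ P? (primeFactors-* m n)) ⟩
    product (filter P? (primeFactors m ++ primeFactors n))
      ≡⟨ cong product (filter-++ P? (primeFactors m) (primeFactors n)) ⟩
    product (filter P? (primeFactors m) ++ filter P? (primeFactors n))
      ≡⟨ cong (λ ps → product (ps ++ filter P? (primeFactors n))) none ⟩
    product (filter P? (primeFactors n)) ∎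
    where
    open ≡-Reasoning
    none : filter P? (primeFactors m) ≡ []
    none = filter-none P? (All.map (λ p∣m Pp → P⇒∤m Pp p∣m) (primeFactors-∣ m))

-- Divisibility by primes, and parity.

∣n⇒∣m*n : ∀ d x y → d ∣ y → d ∣ x ℤ.* y
∣n⇒∣m*n d x y d∣y = Signed.∣⇒∣ᵤ {d} {x ℤ.* y} (Signed.∣n⇒∣m*n x (Signed.∣ᵤ⇒∣ {d} {y} d∣y))

-- `∣` compares absolute values, which do not respect sums, so the argument passes through signed
-- divisibility.
∣-*+* : ∀ d a x b y → d ∣ x → d ∣ y → d ∣ a ℤ.* x ℤ.+ b ℤ.* y
∣-*+* d a x b y d∣x d∣y = Signed.∣⇒∣ᵤ {d} (Signed.∣m∣n⇒∣m+n
  (Signed.∣n⇒∣m*n a (Signed.∣ᵤ⇒∣ {d} {x} d∣x)) (Signed.∣n⇒∣m*n b (Signed.∣ᵤ⇒∣ {d} {y} d∣y)))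

prime∣* : ∀ {p} → Prime p → ∀ x y → + p ∣ x ℤ.* y → (+ p ∣ x) ⊎ (+ p ∣ y)
prime∣* {p} pp x y p∣xy =
  euclidsLemma ∣ x ∣ ∣ y ∣ pp (subst (p ℕ∣.∣_) (ℤ.abs-* x y) p∣xy)

prime∣^ : ∀ {p} → Prime p → ∀ m n → p ℕ∣.∣ m ^ n → p ℕ∣.∣ m
prime∣^ pp m zero    p∣1 = contradiction (subst Prime (ℕ∣.∣1⇒≡1 p∣1) pp) ¬prime[1]
prime∣^ pp m (suc n) p∣  = [ id , prime∣^ pp m n ]′ (euclidsLemma m (m ^ n) pp p∣)

∣⇒∣^ : ∀ {d m n} → 1 ≤ n → d ℕ∣.∣ m → d ℕ∣.∣ m ^ n
∣⇒∣^ {n = suc n} _ d∣m = ℕ∣.∣m⇒∣m*n _ d∣m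

2∣m⊎2∣1+m : ∀ m → 2 ℕ∣.∣ m ⊎ 2 ℕ∣.∣ suc m
2∣m⊎2∣1+m zero    = inj₁ (2 ℕ∣.∣0)
2∣m⊎2∣1+m (suc m) = [ inj₂ ∘ ℕ∣.∣m∣n⇒∣m+n ℕ∣.∣-refl , inj₁ ]′ (2∣m⊎2∣1+m m)

odd+odd : ∀ m n → 2 ∤ m → 2 ∤ n → 2 ℕ∣.∣ m + n
odd+odd m n 2∤m 2∤n with 2∣m⊎2∣1+m m | 2∣m⊎2∣1+m n
... | inj₁ 2∣m   | _          = contradiction 2∣m 2∤m
... | inj₂ _     | inj₁ 2∣n   = contradiction 2∣n 2∤n
-- The sum of `1 + m` and `1 + n` is `2 + (m + n)`, from which the summand 2 is removed.
... | inj₂ 2∣1+m | inj₂ 2∣1+n = ℕ∣.∣m+n∣m⇒∣n {m = 2}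
  (subst (2 ℕ∣.∣_) (cong suc (ℕ.+-suc m n)) (ℕ∣.∣m∣n⇒∣m+n 2∣1+m 2∣1+n)) ℕ∣.∣-refl

n<2*n : ∀ {n} → 1 ≤ n → n < 2 * n
n<2*n {n} 1≤n = ℕ.m<m+n n (ℕ.≤-trans 1≤n (ℕ.m≤m+n n 0))

pos-^-+ : ∀ m u v → + (m ^ (u + v)) ≡ + (m ^ u) ℤ.* + (m ^ v)
pos-^-+ m u v = trans (cong +_ (ℕ.^-distribˡ-+-* m u v)) (ℤ.pos-* (m ^ u) (m ^ v))

-- Identities between differences and sums of powers.

module _ (k h : ℕ) where

  private
    K H K-H K+H : ℕ → ℤ
    K u = + (k ^ u)
    H u = + (h ^ u)
    K-H u = K u ℤ.- H u
    K+H u = K u ℤ.+ H u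

  K-H-double : ∀ n → K-H (2 * n) ≡ K-H n ℤ.* K+H n
  K-H-double n = begin
    K-H (2 * n)                   ≡⟨ cong (λ m → K-H (n + m)) (ℕ.+-identityʳ n) ⟩
    K-H (n + n)                   ≡⟨ cong₂ ℤ._-_ (pos-^-+ k n n) (pos-^-+ h n n) ⟩
    K n ℤ.* K n ℤ.- H n ℤ.* H n   ≡⟨ alg (K n) (H n) ⟩
    K-H n ℤ.* K+H n               ∎
    where
    open ≡-Reasoning
    alg : ∀ x y → x ℤ.* x ℤ.- y ℤ.* y ≡ (x ℤ.- y) ℤ.* (x ℤ.+ y)
    alg = solve-∀

  -- The coefficient `+ 1` is kept so that the right side has the shape required by `∣-*+*`;
  -- likewise `- + 1` in `H*K+H`.
  K*K+H : ∀ u v → K u ℤ.* K+H v ≡ + 1 ℤ.* K+H (u + v) ℤ.+ H v ℤ.* K-H u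
  K*K+H u v = trans (alg (K u) (K v) (H u) (H v))
    (cong (λ x → + 1 ℤ.* x ℤ.+ H v ℤ.* K-H u)
      (sym (cong₂ ℤ._+_ (pos-^-+ k u v) (pos-^-+ h u v))))
    where
    alg : ∀ a b c d →
      a ℤ.* (b ℤ.+ d) ≡ + 1 ℤ.* (a ℤ.* b ℤ.+ c ℤ.* d) ℤ.+ d ℤ.* (a ℤ.- c)
    alg = solve-∀

  H*K+H : ∀ n v → H n ℤ.* K+H v ≡ K v ℤ.* K+H n ℤ.+ ℤ.- + 1 ℤ.* K-H (n + v)
  H*K+H n v = trans (alg (K n) (K v) (H n) (H v))
    (cong (λ x → K v ℤ.* K+H n ℤ.+ ℤ.- + 1 ℤ.* x)
      (sym (cong₂ ℤ._-_ (pos-^-+ k n v) (pos-^-+ h n v))))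
    where
    alg : ∀ a b c d →
      c ℤ.* (b ℤ.+ d) ≡ b ℤ.* (a ℤ.+ c) ℤ.+ ℤ.- + 1 ℤ.* (a ℤ.* b ℤ.- c ℤ.* d)
    alg = solve-∀

  module _ {p} (pp : Prime p) where

    -- By `K*K+H`, `p` divides `K u` times `K+H v`, and it cannot divide the power of `k`.
    ∣K-H⇒∣K+H : ∀ {u v} → ¬ p ℕ∣.∣ k → + p ∣ K-H u → + p ∣ K+H (u + v) → + p ∣ K+H v
    ∣K-H⇒∣K+H {u} {v} p∤k p∣- p∣+ =
      [ (λ p∣K → contradiction (prime∣^ pp k u p∣K) p∤k) , id ]′
      (prime∣* pp (K u) (K+H v)
        (subst (+ p ∣_) (sym (K*K+H u v)) (∣-*+* (+ p) (+ 1) (K+H (u + v)) (H v) (K-H u) p∣+ p∣-)))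

    ∣K-H⇒∣K+H′ : ∀ {n v} → ¬ p ℕ∣.∣ h → + p ∣ K-H (n + v) → + p ∣ K+H n → + p ∣ K+H v
    ∣K-H⇒∣K+H′ {n} {v} p∤h p∣- p∣+ =
      [ (λ p∣H → contradiction (prime∣^ pp h n p∣H) p∤h) , id ]′
      (prime∣* pp (H n) (K+H v)
        (subst (+ p ∣_) (sym (H*K+H n v)) (∣-*+* (+ p) (K v) (K+H n) (ℤ.- + 1) (K-H (n + v)) p∣+ p∣-)))

    -- The sum of the two terms is `2 * k ^ n`.
    ∣K-H∣K+H⇒p∣2 : ∀ {n} → ¬ p ℕ∣.∣ k → + p ∣ K-H n → + p ∣ K+H n → p ℕ∣.∣ 2
    ∣K-H∣K+H⇒p∣2 {n} p∤k p∣- p∣+ =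
      [ id , (λ p∣K → contradiction (prime∣^ pp k n p∣K) p∤k) ]′
      (prime∣* pp (+ 2) (K n)
        (subst (+ p ∣_) (alg (K n) (H n)) (∣-*+* (+ p) (+ 1) (K+H n) (+ 1) (K-H n) p∣+ p∣-)))
      where
      alg : ∀ x y → + 1 ℤ.* (x ℤ.+ y) ℤ.+ + 1 ℤ.* (x ℤ.- y) ≡ + 2 ℤ.* x
      alg = solve-∀

  K-H-nonZero : ∀ n .{{_ : NonZero n}} → k ≢ h → NonZero ∣ K-H n ∣
  K-H-nonZero n k≢h = ≢-nonZero λ eq →
    k^n≢h^n (ℤ.+-injective (ℤ.i-j≡0⇒i≡j (K n) (H n) (ℤ.∣i∣≡0⇒i≡0 eq)))
    where
    k^n≢h^n : k ^ n ≢ h ^ n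
    k^n≢h^n with ℕ.<-cmp k h
    ... | tri< k<h _ _ = ℕ.<⇒≢ (ℕ.^-monoˡ-< n k<h)
    ... | tri≈ _ k≡h _ = contradiction k≡h k≢h
    ... | tri> _ _ h<k = ℕ.>⇒≢ (ℕ.^-monoˡ-< n h<k)

  -- Transfer of primitivity between the two sequences.

  module _ {n} (1≤n : 1 ≤ n) where

    K-H⇒K+H-primitive : ∀ {p} → PrimitivePrimeDivisor K-H (2 * n) p → PrimitivePrimeDivisor K+H n p
    K-H⇒K+H-primitive {p} (pp , p∣ , prim) = pp , p∣+ , prim+
      where
      p∣+ : + p ∣ K+H n
      p∣+ = [ (λ p∣- → contradiction p∣- (prim (n<2*n 1≤n) 1≤n)) , id ]′
        (prime∣* pp (K-H n) (K+H n) (subst (+ p ∣_) (K-H-double n) p∣))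
      -- `K+H u` divides `K-H (2 * u)`, whose index is still below `2 * n`.
      prim+ : ∀ {u} → u < n → 1 ≤ u → ¬ + p ∣ K+H u
      prim+ {u} u<n 1≤u p∣u = prim (ℕ.*-monoʳ-< 2 u<n) (ℕ.≤-trans 1≤u (ℕ.m≤m+n u _))
        (subst (+ p ∣_) (sym (K-H-double u))
          (∣n⇒∣m*n (+ p) (K-H u) (K+H u) p∣u))

    module _ (n>1⊎odd : 1 < n ⊎ 2 ∤ (k + h)) (coprime : n ≡ 1 → Coprime k h) where

      K+H⇒K-H-primitive : ∀ {p} → PrimitivePrimeDivisor K+H n p → PrimitivePrimeDivisor K-H (2 * n) p
      K+H⇒K-H-primitive {p} (pp , p∣ , prim) = pp , p∣- , prim-
        where
        1<n⇒p∤k+h : 1 < n → p ∤ (k + h)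
        1<n⇒p∤k+h 1<n p∣k+h = prim 1<n ℕ.≤-refl
          (subst (p ℕ∣.∣_) (sym (cong₂ _+_ (ℕ.^-identityʳ k) (ℕ.^-identityʳ h))) p∣k+h)

        -- For `n > 1` a common prime factor would already divide the first term `k + h`; for
        -- `n ≡ 1` coprimality excludes it.
        ¬p∣k×p∣h : p ℕ∣.∣ k → ¬ p ℕ∣.∣ h
        ¬p∣k×p∣h p∣k p∣h with ℕ.m≤n⇒m<n∨m≡n 1≤n
        ... | inj₁ 1<n = 1<n⇒p∤k+h 1<n (ℕ∣.∣m∣n⇒∣m+n p∣k p∣h)
        ... | inj₂ 1≡n = ¬prime[1] (subst Prime (coprime (sym 1≡n) (p∣k , p∣h)) pp)

        p∤k : p ∤ k
        p∤k p∣k = ¬p∣k×p∣h p∣k (prime∣^ pp h n (ℕ∣.∣m+n∣m⇒∣n p∣ (∣⇒∣^ 1≤n p∣k)))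

        p∤h : p ∤ h
        p∤h p∣h = ¬p∣k×p∣h
          (prime∣^ pp k n (ℕ∣.∣m+n∣m⇒∣n (subst (p ℕ∣.∣_) (ℕ.+-comm (k ^ n) _) p∣) (∣⇒∣^ 1≤n p∣h)))
          p∣h

        p∤2 : p ∤ 2
        p∤2 p∣2 with prime⇒irreducible prime[2] p∣2
        ... | inj₁ refl = ¬prime[1] pp
        -- Now `p` is 2 and both `k` and `h` are odd, so `k + h` is even. This contradicts
        -- primitivity if `n > 1`, and otherwise the parity hypothesis.
        ... | inj₂ refl = [ 1<n⇒p∤k+h , id ]′ n>1⊎odd (odd+odd k h p∤k p∤h)

        p∣- : + p ∣ K-H (2 * n)
        p∣- = subst (+ p ∣_) (sym (K-H-double n))
          (∣n⇒∣m*n (+ p) (K-H n) (K+H n) p∣)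

        prim- : ∀ {u} → u < 2 * n → 1 ≤ u → ¬ + p ∣ K-H u
        prim- {u} u<2n 1≤u p∣u with ℕ.<-cmp u n
        ... | tri≈ _ refl _ = p∤2 (∣K-H∣K+H⇒p∣2 pp {n} p∤k p∣u p∣)
        -- Here `v` is `n - u`: it is below `n` because `u` is positive, and positive because
        -- `u < n`. So `p` would divide an earlier sum.
        ... | tri< u<n _ _ with v , refl ← ℕ.m≤n⇒∃[o]m+o≡n (ℕ.<⇒≤ u<n) =
          prim {v} (ℕ.m<n+m v 1≤u)
            (ℕ.+-cancelˡ-< u 0 v (subst (_< u + v) (sym (ℕ.+-identityʳ u)) u<n))
            (∣K-H⇒∣K+H pp {u} {v} p∤k p∣u p∣)
        -- Here `v` is `u - n`. Its bound `v < n` comes from cancelling `n` in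
        -- `n + v < n + (n + 0)`, the unfolded form of `u < 2 * n`.
        ... | tri> _ _ n<u with v , refl ← ℕ.m≤n⇒∃[o]m+o≡n (ℕ.<⇒≤ n<u) =
          prim {v}
            (subst (v <_) (ℕ.+-identityʳ n) (ℕ.+-cancelˡ-< n v (n + 0) u<2n))
            (ℕ.+-cancelˡ-< n 0 v (subst (_< n + v) (sym (ℕ.+-identityʳ n)) n<u))
            (∣K-H⇒∣K+H′ pp {n} {v} p∤h p∣u p∣)

theorem11 : ∀ (n k h : ℕ) → 1 ≤ n → 1 ≤ k → 1 ≤ h → k ≢ h →
    (1 < n ⊎ 2 ∤ (k + h)) →
    (n ≡ 1 → Coprime k h) →
    ζ n k h ≡ 𝒵 (2 * n) k h
theorem11 n k h 1≤n 1≤k 1≤h k≢h n>1⊎odd coprime = begin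
  product (filter P? (primeFactors ∣ K+H ∣))
    ≡⟨ cong product (filter-≐ P? Q?
         (K+H⇒K-H-primitive k h 1≤n n>1⊎odd coprime , K-H⇒K+H-primitive k h 1≤n)
         (primeFactors ∣ K+H ∣)) ⟩
  product (filter Q? (primeFactors ∣ K+H ∣))
    -- The factor `K-H` can be inserted freely: a prime primitive at `2 * n` does not divide the
    -- earlier term at `n`.
    ≡⟨ product-filter-primeFactors-* Q? ∣ K-H ∣ ∣ K+H ∣ Q⇒∤K-H ⟨
  product (filter Q? (primeFactors (∣ K-H ∣ * ∣ K+H ∣)))
    ≡⟨ cong (product ∘ filter Q? ∘ primeFactors)
         (trans (cong ∣_∣ (K-H-double k h n)) (ℤ.abs-* K-H K+H)) ⟨
  𝒵 (2 * n) k h ∎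
  where
  open ≡-Reasoning
  K-H K+H : ℤ
  K-H = + (k ^ n) ℤ.- + (h ^ n)
  K+H = + (k ^ n) ℤ.+ + (h ^ n)

  P? = primitivePrimeDivisor? (λ u → + (k ^ u) ℤ.+ + (h ^ u)) n
  Q? = primitivePrimeDivisor? (λ u → + (k ^ u) ℤ.- + (h ^ u)) (2 * n)

  instance
    n≢0 : NonZero n
    n≢0 = >-nonZero 1≤n
    k≢0 : NonZero k
    k≢0 = >-nonZero 1≤k
    K-H≢0 : NonZero ∣ K-H ∣
    K-H≢0 = K-H-nonZero k h n k≢h
    K+H≢0 : NonZero ∣ K+H ∣
    K+H≢0 = >-nonZero (ℕ.≤-trans (ℕ.m^n>0 k n) (ℕ.m≤m+n (k ^ n) (h ^ n)))

  Q⇒∤K-H : ∀ {p} → PrimitivePrimeDivisor (λ u → + (k ^ u) ℤ.- + (h ^ u)) (2 * n) p → p ∤ ∣ K-H ∣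
  Q⇒∤K-H (_ , _ , prim) = prim (n<2*n 1≤n) 1≤n
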